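{- For every Boolean function $f:2^V\to\{0,1\}$, the implicate-dual $f^i$ is hypergraph Horn.
   Context: $V$ is a finite set of Boolean variables. A Boolean function on $V$ is a map $f:2^V\to\{0,1\}$; its true sets are the sets $Z\subseteq V$ with $f(Z)=1$, and $\mathcal{T}(f)$ is the family of true sets. Write $f\le g$ if $f(X)\le g(X)$ for all $X\subseteq V$. For $B\subsetneq V$ and $v\in V\setminus B$, the definite Horn clause $B\to v$ is the Boolean function whose true sets are the sets $T$ with $B\not\subseteq T$ or $B\cup\{v\}\subseteq T$. It is an implicate of $f$ if $f\le (B\to v)$. For a hypergraph $\mathcal{H}\subseteq 2^V$ let $\Phi_{\mathcal{H}}=\bigwedge_{H\in\mathcal{H}}\bigwedge_{v\in H}((H\setminus\{v\})\to v)$ (the empty conjunction is the constant $1$). A Boolean function is hypergraph Horn if it equals $\Phi_{\mathcal{H}}$ for some hypergraph $\mathcal{H}\subseteq 2^V$. A set $I\subseteq V$ is an implicate set of $f$ if $(I\setminus\{v\})\to v$ is an implicate of $f$ for all $v\in I$; $\mathcal{I}(f)$ is the family of implicate sets. The implicate-dual $f^i$ of a Boolean function $f$ is the Boolean function defined by $\mathcal{T}(f^i)=\{V\setminus I\mid I\in\mathcal{I}(f)\}$. -}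

module Defs where

open import Data.Bool.Base using (Bool; true; _≤_)
open import Data.Bool.Properties using (_≤?_) renaming (_≟_ to _≟ᵇ_)
open import Data.Fin.Base using (Fin)
open import Data.Fin.Properties using (all?)
open import Data.Fin.Subset using (Subset; inside; outside; _∈_; _⊆_; _⊈_; _∪_; _-_; ∁; ⁅_⁆)
open import Data.Fin.Subset.Properties using (_∈?_; _⊆?_; anySubset?)
open import Data.Nat.Base using (ℕ; zero; suc)
open import Data.Product.Base using (∃; _×_; _,_; uncurry)
open import Data.Sum.Base using (_⊎_)
open import Data.Vec.Base using ([]; _∷_)
open import Data.Vec.Properties using (≡-dec)
open import Function.Base using (_∘_)
open import Level using (Level)
open import Relation.Binary.PropositionalEquality using (_≡_; _≗_)
open import Relation.Nullary using (Dec; does; ¬?; _×-dec_; _⊎-dec_; _→-dec_)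
open import Relation.Nullary.Decidable using (map′)
open import Relation.Unary using (Pred; Decidable)

private
  variable
    ℓ : Level
    n : ℕ

allSubset? : {P : Pred (Subset n) ℓ} → Decidable P → Dec (∀ X → P X)
allSubset? {n = zero}  P? = map′ (λ { p [] → p }) (λ p → p []) (P? [])
allSubset? {n = suc _} P? = map′
  (λ { (p , q) (inside ∷ X) → p X ; (p , q) (outside ∷ X) → q X })
  (λ p → (λ X → p (inside ∷ X)) , (λ X → p (outside ∷ X)))
  (allSubset? (P? ∘ (inside ∷_)) ×-dec allSubset? (P? ∘ (outside ∷_)))

-- The variable set V is Fin n.
BooleanFunction : ℕ → Set
BooleanFunction n = Subset n → Bool

-- A family of subsets of V, given by its characteristic function.
Hypergraph : ℕ → Set
Hypergraph n = Subset n → Bool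

infix 4 _∈ₕ_ _≤ᶠ_

_∈ₕ_ : Subset n → Hypergraph n → Set
H ∈ₕ ℋ = ℋ H ≡ true

𝒯 : BooleanFunction n → Pred (Subset n) _
𝒯 f Z = f Z ≡ true

_≤ᶠ_ : BooleanFunction n → BooleanFunction n → Set
f ≤ᶠ g = ∀ X → f X ≤ g X

-- The Boolean function whose true sets are exactly the sets satisfying P.
⟦_⟧ : {P : Pred (Subset n) ℓ} → Decidable P → BooleanFunction n
⟦ P? ⟧ Z = does (P? Z)

-- Definite Horn clauses have v ∉ B (hence B ⊊ V); below, B is always of the
-- form H - v.
ClauseTrue : Subset n → Fin n → Pred (Subset n) _
ClauseTrue B v T = B ⊈ T ⊎ B ∪ ⁅ v ⁆ ⊆ T

clauseTrue? : (B : Subset n) (v : Fin n) → Decidable (ClauseTrue B v)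
clauseTrue? B v T = ¬? (B ⊆? T) ⊎-dec (B ∪ ⁅ v ⁆ ⊆? T)

infix 5 _⇾_

_⇾_ : Subset n → Fin n → BooleanFunction n
B ⇾ v = ⟦ clauseTrue? B v ⟧

Implicate : BooleanFunction n → Subset n → Fin n → Set
Implicate f B v = f ≤ᶠ (B ⇾ v)

ΦTrue : Hypergraph n → Pred (Subset n) _
ΦTrue ℋ Z = ∀ H → H ∈ₕ ℋ → ∀ v → v ∈ H → 𝒯 ((H - v) ⇾ v) Z

Φ? : (ℋ : Hypergraph n) → Decidable (ΦTrue ℋ)
Φ? ℋ Z = allSubset? λ H → (ℋ H ≟ᵇ true) →-dec
  all? λ v → (v ∈? H) →-dec (((H - v) ⇾ v) Z ≟ᵇ true)

Φ : Hypergraph n → BooleanFunction n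
Φ ℋ = ⟦ Φ? ℋ ⟧

HypergraphHorn : BooleanFunction n → Set
HypergraphHorn f = ∃ λ ℋ → f ≗ Φ ℋ

ImplicateSet : BooleanFunction n → Pred (Subset n) _
ImplicateSet f I = ∀ v → v ∈ I → Implicate f (I - v) v

implicateSet? : (f : BooleanFunction n) → Decidable (ImplicateSet f)
implicateSet? f I = all? λ v → (v ∈? I) →-dec
  allSubset? λ X → f X ≤? ((I - v) ⇾ v) X

DualTrue : BooleanFunction n → Pred (Subset n) _
DualTrue f Z = ∃ λ I → ImplicateSet f I × Z ≡ ∁ I

dualTrue? : (f : BooleanFunction n) → Decidable (DualTrue f)
dualTrue? f Z = anySubset? λ I → implicateSet? f I ×-dec ≡-dec _≟ᵇ_ Z (∁ I)

infix 8 _ⁱ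

_ⁱ : BooleanFunction n → BooleanFunction n
f ⁱ = ⟦ dualTrue? f ⟧

{-# OPTIONS --safe #-}

-- Put ℋ = { V ∖ T ∣ T a true set of f }.  A set T satisfies all the clauses
-- (I ∖ {v}) → v with v ∈ I iff ∣ I ∖ T ∣ ≠ 1.  Since I ∖ T = I ∩ (V ∖ T) is
-- symmetric in I and V ∖ T, the set I is an implicate set of f iff V ∖ I
-- satisfies the clauses of every H ∈ ℋ; hence fⁱ = Φ ℋ.
module Submission where

open import Defs
open import Algebra.Lattice.Properties.BooleanAlgebra using (¬-involutive)
open import Data.Bool.Base using (Bool; true; false; _≤_; b≤b)
open import Data.Bool.Properties using (≤-minimum)
open import Data.Empty using (⊥-elim)
open import Data.Fin.Base using (Fin; zero; suc)
open import Data.Fin.Subset using (Subset; _∈_; _∉_; _⊆_; _∪_; _-_; ∁; ⁅_⁆)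
open import Data.Fin.Subset.Properties
  using ( _∈?_; _⊆?_; x∈⁅x⁆; x∈⁅y⁆⇒x≡y; x∈p∪q⁻; x∈p∪q⁺; x∈p∧x≢y⇒x∈p-y; p─q⊆p
        ; x∈p⇒x∉∁p; x∉p⇒x∈∁p; ∪-∩-booleanAlgebra)
open import Data.Nat.Base using (ℕ)
open import Data.Product.Base using (_,_)
open import Data.Sum.Base using (inj₁; inj₂)
open import Data.Vec.Base using (_∷_; there)
open import Function.Base using (_∘_)
open import Function.Bundles using (mk⇔)
open import Relation.Binary.PropositionalEquality using (_≡_; refl; sym; trans; cong; subst)
open import Relation.Nullary using (Dec; does; yes; no; contradiction)
open import Relation.Nullary.Decidable using (dec-true; does-⇔)

private
  variable
    n : ℕ

does-true⇒ : ∀ {a} {A : Set a} (a? : Dec A) → does a? ≡ true → A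
does-true⇒ (yes a) _ = a

≤-fromTrue : ∀ {b c : Bool} → (b ≡ true → c ≡ true) → b ≤ c
≤-fromTrue {false} {c} _ = ≤-minimum c
≤-fromTrue {true}      h with refl ← h refl = b≤b

≤-toTrue : ∀ {b c : Bool} → b ≤ c → b ≡ true → c ≡ true
≤-toTrue b≤b b≡true = b≡true

∁-involutive : (p : Subset n) → ∁ (∁ p) ≡ p
∁-involutive {n} = ¬-involutive (∪-∩-booleanAlgebra n)

x∉p-x : (p : Subset n) (x : Fin n) → x ∉ p - x
-- The head of `p - zero` is `outside`, so the index `zero` leaves no case.
x∉p-x (_ ∷ p) (suc x) (there x∈p-x) = x∉p-x p x x∈p-x

SatisfiesClauses : Subset n → Subset n → Set
SatisfiesClauses A T = ∀ v → v ∈ A → 𝒯 ((A - v) ⇾ v) T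

-- The clause of `A` at `v` fails on `∁ B` exactly when `A` and `B` meet in `v` alone, a condition
-- symmetric in `A` and `B`.
satisfiesClauses-swap : (A B : Subset n) →
  SatisfiesClauses A (∁ B) → SatisfiesClauses B (∁ A)
satisfiesClauses-swap A B sat v v∈B = dec-true (clauseTrue? (B - v) v (∁ A)) clause
  where
  clause : ClauseTrue (B - v) v (∁ A)
  clause with (B - v) ⊆? ∁ A | v ∈? A
  ... | no  B-v⊈∁A | _       = inj₁ B-v⊈∁A
  ... | yes B-v⊆∁A | no  v∉A = inj₂ B-v∪v⊆∁A
    where
    B-v∪v⊆∁A : (B - v) ∪ ⁅ v ⁆ ⊆ ∁ A
    B-v∪v⊆∁A x∈ with x∈p∪q⁻ (B - v) ⁅ v ⁆ x∈
    ... | inj₁ x∈B-v = B-v⊆∁A x∈B-v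
    ... | inj₂ x∈⁅v⁆ with refl ← x∈⁅y⁆⇒x≡y v x∈⁅v⁆ = x∉p⇒x∈∁p v∉A
  -- Here `A` and `B` would meet only in `v`, so both ways of satisfying the clause of `A` at `v`
  -- are refuted.
  ... | yes B-v⊆∁A | yes v∈A with does-true⇒ (clauseTrue? (A - v) v (∁ B)) (sat v v∈A)
  ...   | inj₂ A⊆∁B   = contradiction (A⊆∁B (x∈p∪q⁺ (inj₂ (x∈⁅x⁆ v)))) (x∈p⇒x∉∁p v∈B)
  ...   | inj₁ A-v⊈∁B = ⊥-elim (A-v⊈∁B A-v⊆∁B)
    where
    A-v⊆∁B : A - v ⊆ ∁ B
    -- An `x` in `B` other than `v` lies in `B - v`, hence outside `A`.
    A-v⊆∁B x∈A-v = x∉p⇒x∈∁p λ x∈B →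
      x∈p⇒x∉∁p (p─q⊆p A ⁅ v ⁆ x∈A-v)
        (B-v⊆∁A (x∈p∧x≢y⇒x∈p-y x∈B λ { refl → x∉p-x A v x∈A-v }))

dualTrue⇒ΦTrue : (f : BooleanFunction n) (Z : Subset n) →
  DualTrue f Z → ΦTrue (f ∘ ∁) Z
-- `f∁H` makes `∁ H` a true set of `f`, so every clause of `I` holds on it.
dualTrue⇒ΦTrue f _ (I , imp , refl) H f∁H = satisfiesClauses-swap I H
  λ v v∈I → ≤-toTrue (imp v v∈I (∁ H)) f∁H

ΦTrue⇒dualTrue : (f : BooleanFunction n) (Z : Subset n) →
  ΦTrue (f ∘ ∁) Z → DualTrue f Z
ΦTrue⇒dualTrue f Z sat = ∁ Z , imp , sym (∁-involutive Z)
  where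
  imp : ImplicateSet f (∁ Z)
  imp v v∈∁Z T = ≤-fromTrue λ fT →
    -- For a true set `T`, `∁ T` is a hyperedge. Its clauses hold on `Z`, read as `∁ (∁ Z)`;
    -- swapping gives those of `∁ Z` on `∁ (∁ T)`, which is `T`.
    subst (SatisfiesClauses (∁ Z)) (∁-involutive T)
      (satisfiesClauses-swap (∁ T) (∁ Z)
        (subst (SatisfiesClauses (∁ T)) (sym (∁-involutive Z))
          (sat (∁ T) (trans (cong f (∁-involutive T)) fT))))
      v v∈∁Z

lemma16 : (n : ℕ) (f : BooleanFunction n) → HypergraphHorn (f ⁱ)
lemma16 n f = f ∘ ∁ , λ Z →
  does-⇔ (mk⇔ (dualTrue⇒ΦTrue f Z) (ΦTrue⇒dualTrue f Z)) (dualTrue? f Z) (Φ? (f ∘ ∁) Z)
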